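{- For all integers $t,n\ge 2$ we have $R_{nest}(t,n)=2(t(n-1)+1)$.
   Context: The ordered complete graph on $[m]=\{1,\dots,m\}$ is the complete graph with vertex set $[m]$, taken with its natural ordering; edges are written $(i,j)$ with $i<j$. Two edges are independent if they share no vertex; independent edges $(a,b)$ and $(c,d)$ are nested if $a<c<d<b$ or $c<a<b<d$. A matching is a set of pairwise independent edges; it is nested if any two of its edges are nested, and monochromatic if all its edges have the same color. $R_{nest}(t,n)$ denotes the smallest $m$ such that in every coloring of the edges of the ordered complete graph on $[m]$ with $t$ colors there is a monochromatic nested matching with $n$ edges. -}

module Defs where

open import Data.Fin using (Fin; _<_)
open import Data.List using (List; length)
open import Data.List.Relation.Unary.All using (All)
open import Data.List.Relation.Unary.AllPairs using (AllPairs)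
open import Data.Nat as ℕ using (ℕ)
open import Data.Product using (∃-syntax; _×_)
open import Data.Sum using (_⊎_)
open import Relation.Binary.PropositionalEquality using (_≡_; _≢_)

-- The vertex set [m] = {1,…,m} is represented by Fin m; only its order matters.
-- The proof of left < right is unique, so an edge is determined by its
-- endpoints.
record Edge (m : ℕ) : Set where
  constructor edge
  field
    left       : Fin m
    right      : Fin m
    left<right : left < right

open Edge public

Independent : ∀ {m} → Edge m → Edge m → Set
Independent e f =
  left e ≢ left f × left e ≢ right f × right e ≢ left f × right e ≢ right f

Nested : ∀ {m} → Edge m → Edge m → Set
Nested e f = Independent e f ×
  ( (left e < left f × left f < right f × right f < right e)
  ⊎ (left f < left e × left e < right e × right e < right f))

-- A finite set of edges is given as a list. Independent is irreflexive, so a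
-- list satisfying IsMatching has no repetitions, and its length is the number
-- of edges. Independent and Nested are symmetric, so the order in which
-- AllPairs compares two entries does not matter.
IsMatching : ∀ {m} → List (Edge m) → Set
IsMatching = AllPairs Independent

IsNested : ∀ {m} → List (Edge m) → Set
IsNested = AllPairs Nested

Coloring : ℕ → ℕ → Set
Coloring t m = Edge m → Fin t

IsMonochromatic : ∀ {t m} → Coloring t m → List (Edge m) → Set
IsMonochromatic χ M = ∃[ c ] All (λ e → χ e ≡ c) M

ForcesNested : ℕ → ℕ → ℕ → Set
ForcesNested t n m = (χ : Coloring t m) →
  ∃[ M ] (IsMatching M × IsNested M × IsMonochromatic χ M × length M ≡ n)

IsLeast : (ℕ → Set) → ℕ → Set
IsLeast P m = P m × (∀ k → P k → m ℕ.≤ k)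

-- R_nest(t,n) = r. A least element is unique, so for given t and n this holds
-- of at most one r.
IsRnest : ℕ → ℕ → ℕ → Set
IsRnest t n r = IsLeast (ForcesNested t n) r

{-# OPTIONS --safe #-}

-- Upper bound: the edges (i, m + 1 − i) of the ordered complete graph on
-- m = 2 (t (n − 1) + 1) vertices form a nested matching with t (n − 1) + 1 edges,
-- so n of them share a color.
-- Lower bound: let D (a, b) = ⌊(b − a − 1) / 2⌋. Nesting strictly decreases D, and
-- D < t (n − 1) when there are at most 2 t (n − 1) + 1 vertices. Color e by the
-- quotient of D e by n − 1; along a monochromatic nested matching the remainders
-- are then distinct, so there are at most n − 1 of them.
module Submission where

open import Defs
open import Data.Nat using (ℕ; zero; suc; _≤_; _<_; _+_; _*_; _∸_; ⌊_/2⌋; z≤n; s≤s; s≤s⁻¹)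
open import Data.Fin as Fin using (Fin; zero; suc; toℕ; fromℕ<; inject≤; opposite;
  quotient; remainder; combine)
open import Data.Fin.Properties as Fin using (combine-remQuot; opposite-prop; pigeonhole;
  toℕ-fromℕ<; toℕ-inject≤; toℕ<n)
open import Data.List using ([]; _∷_; allFin; filter; length; lookup; take)
open import Data.List.Membership.Propositional using (_∈_)
open import Data.List.Membership.Propositional.Properties using (∈-allFin; ∈-lookup)
open import Data.List.Properties using (length-tabulate; length-take)
open import Data.List.Relation.Unary.All as All using (All; []; _∷_)
import Data.List.Relation.Unary.All.Properties as All
open import Data.List.Relation.Unary.AllPairs as AllPairs using (AllPairs; []; _∷_)
import Data.List.Relation.Unary.AllPairs.Properties as AllPairs
open import Data.List.Relation.Unary.Any using (here; there)
open import Data.Nat.Properties hiding (_≟_)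
open import Data.Nat.Tactic.RingSolver using (solve-∀)
open import Data.Product using (∃-syntax; _×_; _,_; proj₁)
open import Data.Sum using (inj₁; inj₂)
open import Function using (_∘_)
open import Level using (0ℓ)
open import Relation.Binary using (DecidableEquality; Rel)
open import Relation.Binary.PropositionalEquality
open import Relation.Nullary using (¬_; yes; no; contradiction)
open import Relation.Unary using (Pred; Decidable)
open import Relation.Unary.Properties using (∁?)

module _ {A : Set} {P : Pred A 0ℓ} (P? : Decidable P) where

  length-filter-∁ : ∀ xs → length (filter P? xs) + length (filter (∁? P?) xs) ≡ length xs
  length-filter-∁ []       = refl
  length-filter-∁ (x ∷ xs) with P? x
  ... | yes _ = cong suc (length-filter-∁ xs)
  ... | no  _ = trans (+-suc _ _) (cong suc (length-filter-∁ xs))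

module _ {A B : Set} (_≟_ : DecidableEquality B) (f : A → B) {R : Rel A 0ℓ} (s : ℕ) where

  -- Induction on the list `cs` of admissible values. Either its head is taken more than `s` times,
  -- or discarding the entries with that value costs at most `s` of them and the strict inequality
  -- survives for the tail. Filtering and truncating only pass to sublists, so `AllPairs R`
  -- persists.
  pigeonhole-AllPairs : ∀ cs {xs} → AllPairs R xs → All (λ x → f x ∈ cs) xs →
    length cs * s < length xs →
    ∃[ c ] ∃[ ys ] (AllPairs R ys × All (λ y → f y ≡ c) ys × length ys ≡ suc s)
  pigeonhole-AllPairs []       _   []       ()
  pigeonhole-AllPairs []       _   (() ∷ _) _
  pigeonhole-AllPairs (c ∷ cs) {xs} rxs f∈ big with suc s ≤? length (filter (λ x → f x ≟ c) xs)
  ... | yes s<len = c , take (suc s) (filter c? xs) ,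
      AllPairs.take⁺ (suc s) (AllPairs.filter⁺ c? rxs) ,
      All.take⁺ (suc s) (All.all-filter c? xs) ,
      trans (length-take (suc s) (filter c? xs)) (m≤n⇒m⊓n≡m s<len)
    where
    c? = λ x → f x ≟ c
  ... | no s≮len = pigeonhole-AllPairs cs (AllPairs.filter⁺ (∁? c?) rxs)
      (All.zipWith drop-head (All.filter⁺ (∁? c?) f∈ , All.all-filter (∁? c?) xs))
      (+-cancelˡ-< s _ _ (begin-strict
        s + length cs * s                                       <⟨ big ⟩
        length xs                                               ≡⟨ length-filter-∁ c? xs ⟨
        length (filter c? xs) + length (filter (∁? c?) xs)      ≤⟨ +-monoˡ-≤ _ (≮⇒≥ s≮len) ⟩
        s + length (filter (∁? c?) xs)                          ∎))
    where
    open ≤-Reasoning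
    c? = λ x → f x ≟ c
    drop-head : ∀ {x} → f x ∈ c ∷ cs × f x ≢ c → f x ∈ cs
    drop-head (here fx≡c , fx≢c) = contradiction fx≡c fx≢c
    drop-head (there fx∈ , _)    = fx∈

AllPairs-lookup : ∀ {A : Set} {R : Rel A 0ℓ} {xs} → AllPairs R xs →
  ∀ {i j} → i Fin.< j → R (lookup xs i) (lookup xs j)
AllPairs-lookup (rx ∷ _)  {zero}  {suc j} _         = All.lookup rx (∈-lookup j)
AllPairs-lookup (_ ∷ rxs) {suc _} {suc _} (s≤s i<j) = AllPairs-lookup rxs i<j

distinct-values⇒length≤ : ∀ {A : Set} {s} (f : A → Fin s) {xs} →
  AllPairs (λ x y → f x ≢ f y) xs → length xs ≤ s
distinct-values⇒length≤ f {xs} distinct = ≮⇒≥ λ s<len →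
  let _ , _ , i<j , fi≡fj = pigeonhole s<len (f ∘ lookup xs)
  in AllPairs-lookup distinct i<j fi≡fj

-- The chain `left e < left f < right f < right e` already separates the four endpoints, which gives
-- independence.
within : ∀ {m} (e f : Edge m) →
  left e Fin.< left f → right f Fin.< right e → Nested e f
within e f a<c d<b =
  ( Fin.<⇒≢ a<c
  , Fin.<⇒≢ (<-trans a<c (left<right f))
  , Fin.<⇒≢ (<-trans (left<right f) d<b) ∘ sym
  , Fin.<⇒≢ d<b ∘ sym
  ) , inj₁ (a<c , left<right f , d<b)

module NestedArcs (N : ℕ) {m : ℕ} (2N≤m : N + N ≤ m) where

  N≤m : N ≤ m
  N≤m = m+n≤o⇒m≤o N 2N≤m

  start end : Fin N → Fin m
  start i = inject≤ i N≤m
  end     = opposite ∘ start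

  toℕ-end : ∀ i → toℕ (end i) ≡ m ∸ suc (toℕ i)
  toℕ-end i = trans (opposite-prop (start i)) (cong (λ a → m ∸ suc a) (toℕ-inject≤ i N≤m))

  start<end : ∀ i → start i Fin.< end i
  start<end i = subst₂ _<_ (sym (toℕ-inject≤ i N≤m)) (sym (toℕ-end i))
    -- Two copies of `suc (toℕ i) ≤ N` add up to at most `N + N ≤ m`.
    (m+n≤o⇒m≤o∸n _ (≤-trans (+-mono-≤ (toℕ<n i) (toℕ<n i)) 2N≤m))

  arc : Fin N → Edge m
  arc i = edge (start i) (end i) (start<end i)

  arc-nested : ∀ {i j} → i Fin.< j → Nested (arc i) (arc j)
  arc-nested {i} {j} i<j = within (arc i) (arc j)
    (subst₂ _<_ (sym (toℕ-inject≤ i N≤m)) (sym (toℕ-inject≤ j N≤m)) i<j)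
    (subst₂ _<_ (sym (toℕ-end j)) (sym (toℕ-end i))
      (∸-monoʳ-< (s≤s i<j) (≤-trans (toℕ<n j) N≤m)))

forcesNested : ∀ t s {m} → let N = suc (t * s) in N + N ≤ m → ForcesNested t (suc s) m
forcesNested t s 2N≤m χ =
  let c , M , nested , mono , len = pigeonhole-AllPairs Fin._≟_ χ s (allFin t)
        (AllPairs.tabulate⁺-< {f = arc} arc-nested) (All.tabulate⁺ {f = arc} (λ i → ∈-allFin (χ (arc i))))
        -- The count is tight: `t` colors with `s` arcs each fall exactly one short of the
        -- `suc (t * s)` arcs.
        (≤-reflexive (trans (cong (λ l → suc (l * s)) (length-tabulate {n = t} (λ i → i)))
                            (sym (length-tabulate arc))))
  in M , AllPairs.map proj₁ nested , nested , (c , mono) , len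
  where open NestedArcs (suc (t * s)) 2N≤m

-- Half the number of vertices strictly between the endpoints, rounded down: the largest size of a
-- nested matching that fits strictly inside the edge.
depth : ∀ {m} → Edge m → ℕ
depth e = ⌊ toℕ (right e) ∸ suc (toℕ (left e)) /2⌋

-- Passing from `e` to `f` loses at least one inner vertex on each side, two in all, and
-- `⌊ 2 + k /2⌋` reduces to `suc ⌊ k /2⌋`.
within⇒depth< : ∀ {m} (e f : Edge m) →
  left e Fin.< left f → right f Fin.< right e → depth f < depth e
within⇒depth< e f a<c d<b = ⌊n/2⌋-mono (begin
  2 + (toℕ (right f) ∸ suc (toℕ (left f)))  ≡⟨ +-∸-assoc 2 (left<right f) ⟨
  2 + toℕ (right f) ∸ suc (toℕ (left f))    ≤⟨ ∸-mono (s≤s d<b) (s≤s a<c) ⟩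
  toℕ (right e) ∸ suc (toℕ (left e))        ∎)
  where open ≤-Reasoning

nested⇒depth≢ : ∀ {m} (e f : Edge m) → Nested e f → depth e ≢ depth f
nested⇒depth≢ e f (_ , inj₁ (a<c , _ , d<b)) = >⇒≢ (within⇒depth< e f a<c d<b)
nested⇒depth≢ e f (_ , inj₂ (c<a , _ , b<d)) = <⇒≢ (within⇒depth< f e c<a b<d)

depth-bound : ∀ {m T} → m ≤ suc (T + T) → (e : Edge m) → depth e < T
-- `⌈ T + T /2⌉` unfolds to `⌊ suc (T + T) /2⌋`, so it suffices that fewer than `T + T` vertices lie
-- strictly between. Vertices count from 0, hence `right e` is at most `T + T`, and at least 1 is
-- subtracted from it.
depth-bound {T = T} m≤ e = subst (depth e <_) (sym (n≡⌈n+n/2⌉ T)) (⌊n/2⌋-mono (s≤s (begin-strict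
  toℕ (right e) ∸ suc (toℕ (left e))  <⟨ ∸-monoʳ-< {o = 0} (s≤s z≤n) (left<right e) ⟩
  toℕ (right e)                       ≤⟨ s≤s⁻¹ (≤-trans (toℕ<n (right e)) m≤) ⟩
  T + T                               ∎)))
  where open ≤-Reasoning

module DepthColoring (t s : ℕ) {m : ℕ} (m≤ : m ≤ suc (t * s + t * s)) where

  depthFin : Edge m → Fin (t * s)
  depthFin e = fromℕ< (depth-bound m≤ e)

  -- Each color class is a block of `s` consecutive depths.
  color : Coloring t m
  color e = quotient s (depthFin e)

  residue : Edge m → Fin s
  residue e = remainder {t} s (depthFin e)

  color-residue-injective : ∀ e f → color e ≡ color f → residue e ≡ residue f → depth e ≡ depth f
  color-residue-injective e f c≡ r≡ = begin
    depth e                                 ≡⟨ toℕ-fromℕ< _ ⟨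
    toℕ (depthFin e)                        ≡⟨ cong toℕ (combine-remQuot {t} s (depthFin e)) ⟨
    toℕ (combine (color e) (residue e))     ≡⟨ cong₂ (λ c r → toℕ (combine c r)) c≡ r≡ ⟩
    toℕ (combine (color f) (residue f))     ≡⟨ cong toℕ (combine-remQuot {t} s (depthFin f)) ⟩
    toℕ (depthFin f)                        ≡⟨ toℕ-fromℕ< _ ⟩
    depth f                                 ∎
    where open ≡-Reasoning

  residues-distinct : ∀ {c M} → IsNested M → All (λ e → color e ≡ c) M →
    AllPairs (λ e f → residue e ≢ residue f) M
  residues-distinct []                          []          = []
  residues-distinct {M = e ∷ _} (ne ∷ nested) (ce ∷ mono) =
    All.zipWith (λ {f} (ef-nested , cf) →
        nested⇒depth≢ e f ef-nested ∘ color-residue-injective e f (trans ce (sym cf)))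
      (ne , mono)
    ∷ residues-distinct nested mono

¬forcesNested : ∀ t s {m} → m ≤ suc (t * s + t * s) → ¬ ForcesNested t (suc s) m
¬forcesNested t s m≤ forces =
  let _ , _ , nested , (_ , mono) , len = forces color
  in 1+n≰n (subst (_≤ s) len
       (distinct-values⇒length≤ residue (residues-distinct nested mono)))
  where open DepthColoring t s m≤

theorem2p17 : (t n : ℕ) → 2 ≤ t → 2 ≤ n → IsRnest t n (2 * (t * (n ∸ 1) + 1))
theorem2p17 t (suc s) _ _ = subst (IsRnest t (suc s)) (N+N≡2[T+1] (t * s))
  ( forcesNested t s ≤-refl
  -- Minimality concerns every smaller `k`, hence the coloring for all `m` up to a bound. Below
  -- `suc T + suc T`, with `T = t * s`, the largest value is `T + suc T`, which is `suc (T + T)`.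
  , λ k forces → ≮⇒≥ λ k< →
      ¬forcesNested t s (subst (k ≤_) (+-suc (t * s) (t * s)) (s≤s⁻¹ k<)) forces
  )
  where
  N+N≡2[T+1] : ∀ T → suc T + suc T ≡ 2 * (T + 1)
  N+N≡2[T+1] = solve-∀
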